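{- Fix integers $k\geq 2$ and $n>r\geq 3$, and integers $s_0,\dots,s_{k-1}$ with $n\geq s_i\geq r+1$ for all $i$. If $n \nrightarrow (s_0,\dots,s_{k-1})^{r}$, then \[ 2^n \nrightarrow (s_0+1,\dots,s_{k-1}+1,\underbrace{r+2,\dots,r+2}_{\eta(r)\text{ terms}})^{r+1}, \] where $\eta(r)=1$ if $r=3$, $\eta(r)=2$ if $r>3$ is even, and $\eta(r)=3$ if $r>3$ is odd. That is, there is a colouring of the $(r+1)$-subsets of $\{0,\dots,2^n-1\}$ with $k+\eta(r)$ colours such that for each $i<k$ no set of size $s_i+1$ is monochromatic in colour $i$, and no set of size $r+2$ is monochromatic in any of the colours $k,\dots,k+\eta(r)-1$.
   Context: For $m\in\mathbb N$ write $[m]=\{0,\dots,m-1\}$ and $\binom{S}{r}$ for the set of $r$-element subsets of $S$. Given $k\geq 2$, $n>r\geq1$, an $r$-subset $k$-colouring of $[n]$ is a function $f:\binom{[n]}{r}\to[k]$; a set $X\subset[n]$ is monochromatic in colour $i$ if $f(T)=i$ for all $T\in\binom{X}{r}$. For integers $s_0,\dots,s_{k-1}$ with $n\geq s_i>r$, the relation $n\to(s_0,\dots,s_{k-1})^r$ means that for every $f:\binom{[n]}{r}\to[k]$ there is a colour $i$ and a subset of $[n]$ of size $s_i$ monochromatic in colour $i$; $n\nrightarrow(\dots)^r$ is its negation. $(s)_k^r$ abbreviates $(s,\dots,s)^r$ with $k$ entries. -}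

module Defs where

open import Data.Bool.Base using (if_then_else_)
open import Data.Fin.Base using (Fin)
open import Data.Fin.Subset using (Subset; _⊆_; ∣_∣)
open import Data.Nat.Base using (ℕ)
open import Data.Nat.Divisibility using (_∣?_)
open import Data.Nat.Properties using (_≟_)
open import Data.Product.Base using (Σ-syntax; ∃-syntax; _×_; proj₁)
open import Data.Vec.Functional using (Vector)
open import Relation.Binary.PropositionalEquality.Core using (_≡_)
open import Relation.Nullary.Decidable.Core using (does)
open import Relation.Nullary.Negation.Core using (¬_)

-- The size proof is unique (ℕ has decidable equality), so a colouring assigns
-- a single colour to each r-element subset.
SubsetOfSize : ℕ → ℕ → Set
SubsetOfSize n r = Σ[ T ∈ Subset n ] ∣ T ∣ ≡ r

Colouring : (n r k : ℕ) → Set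
Colouring n r k = SubsetOfSize n r → Fin k

Monochromatic : ∀ {n r k} → Colouring n r k → Fin k → Subset n → Set
Monochromatic {n} {r} f i X = (T : SubsetOfSize n r) → proj₁ T ⊆ X → f T ≡ i

infix 4 _⟶[_]_ _↛[_]_

-- n ⟶[ r ] s  is  n → (s₀, …, sₖ₋₁)ʳ.
_⟶[_]_ : ∀ {k} → ℕ → ℕ → Vector ℕ k → Set
_⟶[_]_ {k} n r s =
  (f : Colouring n r k) →
  ∃[ i ] Σ[ X ∈ Subset n ] ∣ X ∣ ≡ s i × Monochromatic f i X

_↛[_]_ : ∀ {k} → ℕ → ℕ → Vector ℕ k → Set
n ↛[ r ] s = ¬ (n ⟶[ r ] s)

-- Only the values at r ≥ 3 are meaningful.
η : ℕ → ℕ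
η r = if does (r ≟ 3) then 1 else if does (2 ∣? r) then 2 else 3

{-# OPTIONS --safe #-}
module Submission where

-- Let x₀ < x₁ < … be the elements of a subset of {0, …, 2ⁿ - 1} and let dᵢ be the
-- top binary digit in which xᵢ and xᵢ₊₁ differ.  Record in a word of bits which
-- interior dᵢ are local maxima ("peaks").  Removing min or max of the set
-- removes the first or last letter of the word.
--
-- An (r+1)-set whose word is 0…0 gets the colour g {dᵢ}, where g witnesses
-- n ↛ (s)ʳ.  Other words get a new colour, depending on the position p of the
-- first peak: one colour for even p, one for odd p ≥ 3, one for p = 1.  (If r = 3
-- only p = 1 occurs.  If r is even the third colour is saved: for p = 1, use the
-- odd colour when there is no second peak, and the original colour g {dᵢ}
-- otherwise.)  As no two peaks are adjacent, the two (r+1)-sets obtained from an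
-- (r+2)-set with a peak by removing its minimum or its maximum are then never
-- both in the same new colour, nor both in original colours.
--
-- So a monochromatic set X has no peaks.  Then its dᵢ first decrease and then
-- increase, so they are pairwise distinct and each subset of {dᵢ} is the
-- difference set of a subset of X.  Hence X is not in a new colour, and if X has
-- colour i then {dᵢ} has |X| - 1 elements and is monochromatic in colour i for g.

open import Defs
open import Data.Bool.Base using (Bool; true; false; _∧_; if_then_else_)
open import Data.Bool.ListAction using (or)
open import Data.Empty using (⊥-elim)
open import Data.Fin.Base using (Fin; zero; suc; splitAt; finToFun; funToFin; _↑ˡ_; _↑ʳ_)
open import Data.Fin.Properties
  using (2↔Bool; any?; finToFun-funToFin; splitAt-↑ˡ; splitAt-↑ʳ; splitAt⁻¹-↑ˡ; splitAt⁻¹-↑ʳ;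
         ↑ˡ-injective; ¬∀⟶∃¬)
  renaming (_≟_ to _≟ᶠ_)
open import Data.Fin.Subset using (Subset; _⊆_; ⊥; _∪_; ∣_∣)
open import Data.Fin.Subset.Properties
  using (_⊆?_; anySubset?; ⊆-refl; drop-∷-⊆; ∪-identityˡ; ∪-identityʳ)
open import Data.List.Base using (List; []; _∷_; length; drop)
  renaming (_++_ to _++ᴸ_)
open import Data.List.Properties using (length-++; ++-identityʳ)
open import Data.List.Relation.Unary.All using (All; []; _∷_)
import Data.List.Relation.Unary.All as All
import Data.List.Relation.Unary.All.Properties as All
open import Data.List.Relation.Unary.Linked using (Linked; []; [-]; _∷_)
open import Data.Maybe.Base using (Maybe; just; nothing)
open import Data.Maybe.Properties using (just-injective)
open import Data.Nat.Base using (ℕ; zero; suc; pred; _+_; _∸_; _^_; _≤_; _<_; z≤n; s≤s)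
open import Data.Nat.Divisibility using (_∣_; _∣?_; ∣-refl; ∣m+n∣m⇒∣n)
open import Data.Nat.Properties
  using (_≟_; _<?_; m+n≤o⇒m≤o; m+n≤o⇒n≤o; +-comm; +-suc; +-identityʳ; n<1+n; <-trans; <-asym; ≡-irrelevant;
         suc-injective; m≤n⇒∃[o]m+o≡n)
open import Data.Product.Base using (Σ-syntax; ∃-syntax; _×_; _,_; proj₁; proj₂)
open import Data.Sum.Base using (inj₁; inj₂; [_,_]′)
open import Data.Vec.Base using (Vec; []; _∷_; here; there; lookup; tabulate; take)
  renaming (_++_ to _++ⱽ_; drop to dropⱽ)
open import Data.Vec.Functional using (Vector; map; _++_; replicate)
open import Data.Vec.Properties using (take++drop≡id; tabulate-cong; tabulate∘lookup)
open import Function.Base using (_∘_; const)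
open import Function.Bundles using (Inverse)
open import Relation.Binary.PropositionalEquality
  using (_≡_; _≢_; _≗_; refl; sym; trans; cong; cong₂; subst; module ≡-Reasoning)
open import Relation.Nullary.Decidable
  using (Dec; yes; no; does; from-no; dec-true; decidable-stable; ¬?; _×-dec_)
open import Relation.Nullary.Negation.Core using (¬_; contradiction)

private
  variable
    n h k : ℕ
    A : Set

-- Words and the deletion of an end letter

dropLast : List A → List A
dropLast []           = []
dropLast (_ ∷ [])     = []
dropLast (a ∷ b ∷ as) = a ∷ dropLast (b ∷ as)

dropLast-++ : ∀ (as : List A) {b bs} → dropLast (as ++ᴸ b ∷ bs) ≡ as ++ᴸ dropLast (b ∷ bs)
dropLast-++ []            = refl
dropLast-++ (_ ∷ [])      = refl
dropLast-++ (a ∷ a′ ∷ as) = cong (a ∷_) (dropLast-++ (a′ ∷ as))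

NoTrue : List Bool → Set
NoTrue = All (_≡ false)

-- With at least two letters, each letter survives one of the two deletions.
noTrue-ends : ∀ {m} u → length u ≡ suc (suc m) → NoTrue (drop 1 u) → NoTrue (dropLast u) → NoTrue u
noTrue-ends (_ ∷ _ ∷ _) _ tail (p ∷ _) = p ∷ tail

Sparse : List Bool → Set
Sparse = Linked λ a b → a ∧ b ≡ false

-- Classifying words of peaks

-- `nothing` stands for the original colours, `just j` for the j-th new one.
-- The letter at index p - 1 of a word says whether there is a peak at position p.
record Separating (r h : ℕ) : Set where
  field
    classify : List Bool → Maybe (Fin h)
    noTrue⇒nothing : ∀ {w} → NoTrue w → classify w ≡ nothing
    -- An (r + 2)-set has r + 1 differences, r - 1 of them interior, so its word has this length.
    separates : ∀ u → length u ≡ r ∸ 1 → Sparse u →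
                classify (drop 1 u) ≡ classify (dropLast u) → NoTrue u

parity : Fin h → Fin h → List Bool → Maybe (Fin h)
parity x y []          = nothing
parity x y (true ∷ _)  = just x
parity x y (false ∷ w) = parity y x w

parity-noTrue : ∀ {x y : Fin h} {w} → NoTrue w → parity x y w ≡ nothing
parity-noTrue []         = refl
parity-noTrue (refl ∷ p) = parity-noTrue p

parity-range : ∀ {x y z : Fin h} w → x ≢ z → y ≢ z → parity x y w ≢ just z
parity-range (true ∷ _)  x≢z y≢z eq = x≢z (just-injective eq)
parity-range (false ∷ w) x≢z y≢z eq = parity-range w y≢z x≢z eq

-- Deleting the first letter shifts the first peak by one position, deleting the last does not. The
-- two sides thus give it different colours; if it is the last letter, only one side sees it.
parity-separates : ∀ {x y : Fin h} b w → x ≢ y →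
  parity x y (b ∷ w) ≡ parity y x (dropLast (b ∷ w)) → NoTrue (b ∷ w)
parity-separates false []      x≢y eq = refl ∷ []
parity-separates true  (c ∷ w) x≢y eq = contradiction (just-injective eq) x≢y
parity-separates false (c ∷ w) x≢y eq = refl ∷ parity-separates c w (x≢y ∘ sym) eq

parity-something : ∀ {x y : Fin h} w → or (dropLast w) ≡ true → parity x y w ≢ nothing
parity-something (false ∷ b ∷ w) some eq = parity-something (b ∷ w) some eq

-- Only the last letter can be `true`. The length is odd, so its index from 0 is even and its colour
-- would be `x`.
parity-lastOnly : ∀ {x y : Fin h} w → x ≢ y → 2 ∣ suc (length w) → or (dropLast w) ≡ false →
  parity x y w ≢ just y
parity-lastOnly (true ∷ [])             x≢y _    none eq = x≢y (just-injective eq)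
parity-lastOnly (false ∷ _ ∷ [])        x≢y even none eq = contradiction even (from-no (2 ∣? 3))
parity-lastOnly (false ∷ false ∷ c ∷ w) x≢y even none eq =
  parity-lastOnly (c ∷ w) x≢y (∣m+n∣m⇒∣n even ∣-refl) none eq

-- Single letters are classified here. The two letters of `u` must agree, and sparseness forbids two
-- peaks.
three : Separating 3 1
three = record
  { classify = classify
  ; noTrue⇒nothing = λ { [] → refl ; (refl ∷ _) → refl }
  ; separates = separates
  }
  where
  classify : List Bool → Maybe (Fin 1)
  classify (true ∷ _) = just zero
  classify _          = nothing

  separates : ∀ u → length u ≡ 2 → Sparse u →
    classify (drop 1 u) ≡ classify (dropLast u) → NoTrue u
  separates (false ∷ false ∷ []) _ _        _ = refl ∷ refl ∷ []
  separates (true ∷ true ∷ [])   _ (() ∷ _) _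

-- The third colour marks a peak in the first letter. If one of the first two letters of `u` is a
-- peak, exactly one of the two deletions gives this colour; otherwise `parity-separates` decides.
odd : ∀ q → Separating (4 + q) 3
odd q = record
  { classify = classify
  ; noTrue⇒nothing = λ { [] → refl ; (refl ∷ p) → parity-noTrue p }
  ; separates = separates
  }
  where
  classify : List Bool → Maybe (Fin 3)
  classify []          = nothing
  classify (true ∷ _)  = just (suc (suc zero))
  classify (false ∷ w) = parity zero (suc zero) w

  separates : ∀ u → length u ≡ 3 + q → Sparse u →
    classify (drop 1 u) ≡ classify (dropLast u) → NoTrue u
  separates (true ∷ true ∷ _)              _ (() ∷ _) _
  separates (true ∷ false ∷ b ∷ w)         _ _ eq =
    contradiction eq (parity-range (b ∷ w) (λ ()) (λ ()))
  separates (false ∷ true ∷ _ ∷ _)         _ _ ()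
  separates (false ∷ false ∷ b ∷ w)        _ _ eq =
    refl ∷ refl ∷ parity-separates b w (λ ()) eq

even : ∀ q → 2 ∣ 4 + q → Separating (4 + q) 2
even q 2∣r = record
  { classify = classify
  ; noTrue⇒nothing = λ { [] → refl ; (refl ∷ p) → parity-noTrue p }
  ; separates = separates
  }
  where
  classify : List Bool → Maybe (Fin 2)
  classify []          = nothing
  classify (true ∷ w)  = if or w then nothing else just (suc zero)
  classify (false ∷ w) = parity zero (suc zero) w

  separates : ∀ u → length u ≡ 3 + q → Sparse u →
    classify (drop 1 u) ≡ classify (dropLast u) → NoTrue u
  separates (true ∷ true ∷ _)       _ (() ∷ _) _
  -- If a second peak survives deletion of the last letter, that side is original and the other is
  -- new. If not, that side has colour `suc zero`, which the other avoids by `parity-lastOnly`: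
  -- `b ∷ w` has odd length as r is even.
  separates (true ∷ false ∷ b ∷ w)  len _ eq with or (dropLast (b ∷ w)) in some
  ... | true  = contradiction eq (parity-something (b ∷ w) some)
  ... | false = contradiction eq (parity-lastOnly (b ∷ w) (λ ())
                  (∣m+n∣m⇒∣n (subst (λ l → 2 ∣ suc l) (sym len) 2∣r) ∣-refl) some)
  -- Deleting the last letter leaves the first peak at position 2, hence colour `zero`, which a word
  -- starting with a peak never gets.
  separates (false ∷ true ∷ b ∷ w)  _ _ eq with or (b ∷ w)
  separates (false ∷ true ∷ b ∷ w)  _ _ () | true
  separates (false ∷ true ∷ b ∷ w)  _ _ () | false
  separates (false ∷ false ∷ b ∷ w) _ _ eq =
    refl ∷ refl ∷ parity-separates b w (λ ()) eq

separating : ∀ {r} → 3 ≤ r → Separating r (η r)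
-- The decisions become arguments so that matching on them reduces the conditionals of `η`.
separating {r} 3≤r = go 3≤r (r ≟ 3) (2 ∣? r)
  where
  go : ∀ {r} → 3 ≤ r → (r≟3 : Dec (r ≡ 3)) (2∣?r : Dec (2 ∣ r)) →
    Separating r (if does r≟3 then 1 else if does 2∣?r then 2 else 3)
  go _                               (yes refl) _         = three
  go (s≤s (s≤s (s≤s (z≤n {zero}))))  (no r≢3)   _         = contradiction refl r≢3
  go (s≤s (s≤s (s≤s (z≤n {suc q})))) (no _)     (yes 2∣r) = even q 2∣r
  go (s≤s (s≤s (s≤s (z≤n {suc q})))) (no _)     (no _)    = odd q

-- Words of peaks

peak? : ∀ a b c → Dec (a < b × c < b)
peak? a b c = a <? b ×-dec c <? b

peaks : List ℕ → List Bool
peaks (a ∷ b ∷ c ∷ ds) = does (peak? a b c) ∷ peaks (b ∷ c ∷ ds)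
peaks _                = []

length-peaks : ∀ ds → length (peaks ds) ≡ length ds ∸ 2
length-peaks []               = refl
length-peaks (_ ∷ [])         = refl
length-peaks (_ ∷ _ ∷ [])     = refl
length-peaks (_ ∷ b ∷ c ∷ ds) = cong suc (length-peaks (b ∷ c ∷ ds))

peaks-drop : ∀ ds → peaks (drop 1 ds) ≡ drop 1 (peaks ds)
peaks-drop []              = refl
peaks-drop (_ ∷ [])        = refl
peaks-drop (_ ∷ _ ∷ [])    = refl
peaks-drop (_ ∷ _ ∷ _ ∷ _) = refl

peaks-dropLast : ∀ ds → peaks (dropLast ds) ≡ dropLast (peaks ds)
peaks-dropLast []                   = refl
peaks-dropLast (_ ∷ [])             = refl
peaks-dropLast (_ ∷ _ ∷ [])         = refl
peaks-dropLast (_ ∷ _ ∷ _ ∷ [])     = refl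
peaks-dropLast (a ∷ b ∷ c ∷ d ∷ ds) =
  cong (does (peak? a b c) ∷_) (peaks-dropLast (b ∷ c ∷ d ∷ ds))

peaks-sparse : ∀ ds → Sparse (peaks ds)
peaks-sparse []                   = []
peaks-sparse (_ ∷ [])             = []
peaks-sparse (_ ∷ _ ∷ [])         = []
peaks-sparse (_ ∷ _ ∷ _ ∷ [])     = [-]
peaks-sparse (a ∷ b ∷ c ∷ d ∷ ds) =
  exclusive (peak? a b c) (peak? b c d) (λ ((_ , c<b) , (b<c , _)) → <-asym c<b b<c)
  ∷ peaks-sparse (b ∷ c ∷ d ∷ ds)
  where
  exclusive : ∀ {P Q : Set} (p : Dec P) (q : Dec Q) → ¬ (P × Q) → does p ∧ does q ≡ false
  exclusive (no _)  _       _  = refl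
  exclusive (yes _) (no _)  _  = refl
  exclusive (yes p) (yes q) ¬b = contradiction (p , q) ¬b

PeakFree : List ℕ → Set
PeakFree ds = NoTrue (peaks ds)

peakFree-drop : ∀ ds → PeakFree ds → PeakFree (drop 1 ds)
peakFree-drop ds p = subst NoTrue (sym (peaks-drop ds)) (All.drop⁺ 1 p)

peakFree-++ʳ : ∀ cs {ds} → PeakFree (cs ++ᴸ ds) → PeakFree ds
peakFree-++ʳ []       p = p
peakFree-++ʳ (c ∷ cs) p = peakFree-++ʳ cs (peakFree-drop (c ∷ cs ++ᴸ _) p)

peakFree-++ˡ : ∀ cs {ds} → PeakFree (cs ++ᴸ ds) → PeakFree cs
peakFree-++ˡ []               p       = []
peakFree-++ˡ (_ ∷ [])         p       = []
peakFree-++ˡ (_ ∷ _ ∷ [])     p       = []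
peakFree-++ˡ (_ ∷ b ∷ c ∷ cs) (q ∷ p) = q ∷ peakFree-++ˡ (b ∷ c ∷ cs) p

-- Once all but one of the entries before `m` are dropped, both neighbours of `m` are smaller.
interior-peak : ∀ {m c cs d ds} → All (_< m) (c ∷ cs) → d < m → ¬ PeakFree (c ∷ cs ++ᴸ m ∷ d ∷ ds)
interior-peak {m} {c} {[]}     {d} (c<m ∷ _) d<m (q ∷ _) =
  contradiction (trans (sym (dec-true (peak? c m d) (c<m , d<m))) q) λ ()
interior-peak {cs = _ ∷ cs} (_ ∷ cs<m) d<m p       =
  interior-peak cs<m d<m (peakFree-drop (_ ∷ _ ∷ cs ++ᴸ _) p)

-- Subsets of {0, …, 2ⁿ - 1} as binary trees

-- A node splits a set by its top binary digit, 0 to the left; elements from different halves first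
-- differ in that digit.
data Tree : ℕ → Set where
  leaf : Bool → Tree 0
  node : Tree n → Tree n → Tree (suc n)

infix 4 _⊑_

data _⊑_ : Tree n → Tree n → Set where
  empty : ∀ {b} → leaf false ⊑ leaf b
  same  : ∀ {b} → leaf b ⊑ leaf b
  node  : ∀ {l l′ r r′ : Tree n} → l ⊑ l′ → r ⊑ r′ → node l r ⊑ node l′ r′

⊑-refl : {t : Tree n} → t ⊑ t
⊑-refl {t = leaf _}   = same
⊑-refl {t = node _ _} = node ⊑-refl ⊑-refl

⊑-trans : {t u v : Tree n} → t ⊑ u → u ⊑ v → t ⊑ v
⊑-trans empty      same         = empty
⊑-trans empty      empty        = empty
⊑-trans same       q            = q
⊑-trans (node p q) (node p′ q′) = node (⊑-trans p p′) (⊑-trans q q′)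

∅ : Tree n
∅ {zero}  = leaf false
∅ {suc n} = node ∅ ∅

∅-least : {t : Tree n} → ∅ ⊑ t
∅-least {t = leaf _}   = empty
∅-least {t = node _ _} = node ∅-least ∅-least

size : Tree n → ℕ
size (leaf b)   = if b then 1 else 0
size (node l r) = size l + size r

size-∅ : ∀ n → size (∅ {n}) ≡ 0
size-∅ zero    = refl
size-∅ (suc n) = cong₂ _+_ (size-∅ n) (size-∅ n)

both : ℕ → ℕ → Bool
both (suc _) (suc _) = true
both _       _       = false

both-zeroʳ : ∀ a → both a 0 ≡ false
both-zeroʳ zero    = refl
both-zeroʳ (suc _) = refl

separator : ℕ → Bool → List ℕ
separator n b = if b then n ∷ [] else []

-- The sequence δ(x₀, x₁), δ(x₁, x₂), … of top differing bits of the successive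
-- elements x₀ < x₁ < … of the set.
deltas : Tree n → List ℕ
deltas (leaf _)           = []
deltas (node {n = n} l r) = deltas l ++ᴸ separator n (both (size l) (size r)) ++ᴸ deltas r

-- Digits are listed from the top: index 0 stands for the highest digit. This relabelling is
-- harmless, since `Avoids` depends only on sizes and inclusions.
deltaSet : Tree n → Subset n
deltaSet (leaf _)   = []
deltaSet (node l r) = both (size l) (size r) ∷ (deltaSet l ∪ deltaSet r)

length-deltas : (t : Tree n) → length (deltas t) ≡ pred (size t)
length-deltas (leaf true)  = refl
length-deltas (leaf false) = refl
length-deltas {suc n} (node l r)
  rewrite length-++ (deltas l) {separator n (both (size l) (size r)) ++ᴸ deltas r}
        | length-++ (separator n (both (size l) (size r))) {deltas r}
        | length-deltas l | length-deltas r = arithmetic (size l) (size r)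
  where
  arithmetic : ∀ a b → pred a + (length (separator n (both a b)) + pred b) ≡ pred (a + b)
  arithmetic zero    b       = refl
  arithmetic (suc a) zero    = refl
  arithmetic (suc a) (suc b) = refl

deltas-small : (t : Tree n) → size t ≤ 1 → deltas t ≡ []
deltas-small t t≤1 with deltas t | size t | length-deltas t | t≤1
... | []    | _ | _ | _ = refl
... | _ ∷ _ | suc (suc _) | _ | s≤s ()

deltas-< : (t : Tree n) → All (_< n) (deltas t)
deltas-< (leaf _) = []
deltas-< {suc n} (node l r) =
  All.++⁺ (weaken l) (All.++⁺ (new (both (size l) (size r))) (weaken r))
  where
  weaken : (t : Tree n) → All (_< suc n) (deltas t)
  weaken t = All.map (λ d<n → <-trans d<n (n<1+n n)) (deltas-< t)

  new : ∀ b → All (_< suc n) (separator n b)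
  new true  = n<1+n n ∷ []
  new false = []

-- Removing the minimum or the maximum

dropMin : Tree n → Tree n
dropMin (leaf _)   = leaf false
dropMin (node l r) with size l
... | zero  = node l (dropMin r)
... | suc _ = node (dropMin l) r

dropMax : Tree n → Tree n
dropMax (leaf _)   = leaf false
dropMax (node l r) with size r
... | zero  = node (dropMax l) r
... | suc _ = node l (dropMax r)

dropMin-⊑ : (t : Tree n) → dropMin t ⊑ t
dropMin-⊑ (leaf _)   = empty
dropMin-⊑ (node l r) with size l
... | zero  = node ⊑-refl (dropMin-⊑ r)
... | suc _ = node (dropMin-⊑ l) ⊑-refl

dropMax-⊑ : (t : Tree n) → dropMax t ⊑ t
dropMax-⊑ (leaf _)   = empty
dropMax-⊑ (node l r) with size r
... | zero  = node (dropMax-⊑ l) ⊑-refl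
... | suc _ = node ⊑-refl (dropMax-⊑ r)

size-dropMin : (t : Tree n) → size (dropMin t) ≡ pred (size t)
size-dropMin (leaf true)  = refl
size-dropMin (leaf false) = refl
size-dropMin (node l r) with size l in eq
... | zero  rewrite eq | size-dropMin r = refl
... | suc a rewrite size-dropMin l | eq = refl

size-dropMax : (t : Tree n) → size (dropMax t) ≡ pred (size t)
size-dropMax (leaf true)  = refl
size-dropMax (leaf false) = refl
size-dropMax (node l r) with size r in eq
... | zero  rewrite eq | size-dropMax l | +-identityʳ (size l) | +-identityʳ (pred (size l)) = refl
... | suc b rewrite size-dropMax r | eq | +-suc (size l) b = refl

-- The first difference lies in `r` if `l` is empty, is the separator (if any) if `l` is a
-- singleton, and lies in `l` otherwise.
deltas-dropMin : (t : Tree n) → deltas (dropMin t) ≡ drop 1 (deltas t)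
deltas-dropMin (leaf _) = refl
deltas-dropMin (node l r) with size l in eq
... | zero
  rewrite eq | deltas-small l (subst (_≤ 1) (sym eq) z≤n) = deltas-dropMin r
deltas-dropMin {suc n} (node l r) | suc zero
  rewrite size-dropMin l | eq | deltas-dropMin l | deltas-small l (subst (_≤ 1) (sym eq) (s≤s z≤n))
  with size r in eq′
... | zero rewrite deltas-small r (subst (_≤ 1) (sym eq′) z≤n) = refl
... | suc _ = refl
deltas-dropMin (node l r) | suc (suc a)
  rewrite size-dropMin l | eq | deltas-dropMin l
  with deltas l | length-deltas l
... | []    | len = contradiction (trans len (cong pred eq)) λ ()
... | _ ∷ _ | _ with size r
...   | zero  = refl
...   | suc _ = refl

deltas-dropMax : (t : Tree n) → deltas (dropMax t) ≡ dropLast (deltas t)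
deltas-dropMax (leaf _) = refl
deltas-dropMax {suc n} (node l r) with size r in eq
... | zero
  rewrite eq | both-zeroʳ (size l) | both-zeroʳ (size (dropMax l))
        | deltas-small r (subst (_≤ 1) (sym eq) z≤n)
        | ++-identityʳ (deltas l) | ++-identityʳ (deltas (dropMax l)) = deltas-dropMax l
... | suc zero
  rewrite size-dropMax r | eq | deltas-dropMax r | deltas-small r (subst (_≤ 1) (sym eq) (s≤s z≤n))
        | both-zeroʳ (size l)
  with size l in eq′
...   | zero rewrite deltas-small l (subst (_≤ 1) (sym eq′) z≤n) = refl
...   | suc _ = sym (dropLast-++ (deltas l))
deltas-dropMax {suc n} (node l r) | suc (suc b)
  rewrite size-dropMax r | eq | deltas-dropMax r
  with deltas r | length-deltas r
... | []     | len = contradiction (trans len (cong pred eq)) λ ()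
... | d ∷ ds | _ with size l
...   | zero  = sym (dropLast-++ (deltas l))
...   | suc _ = sym (dropLast-++ (deltas l))

-- A node both of whose halves have two elements would contribute a peak.
data VShaped : Tree n → Set where
  leaf  : VShaped (leaf true)
  right : {l r : Tree n} → size l ≤ 1 → VShaped r → VShaped (node l r)
  left  : {l r : Tree n} → VShaped l → size r ≤ 1 → VShaped (node l r)

peakFree⇒VShaped : (t : Tree n) → 1 ≤ size t → PeakFree (deltas t) → VShaped t
peakFree⇒VShaped (leaf true) _ _ = leaf
peakFree⇒VShaped {suc n} (node l r) t≥1 p = by-sizes (size l) (size r) refl refl
  where
  right-free : PeakFree (deltas r)
  right-free = peakFree-++ʳ (separator n (both (size l) (size r))) (peakFree-++ʳ (deltas l) p)

  left-free : PeakFree (deltas l)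
  left-free = peakFree-++ˡ (deltas l) p

  by-sizes : ∀ a b → size l ≡ a → size r ≡ b → VShaped (node l r)
  by-sizes zero b l≡0 r≡b =
    right (subst (_≤ 1) (sym l≡0) z≤n)
          (peakFree⇒VShaped r (subst (λ a → 1 ≤ a + size r) l≡0 t≥1) right-free)
  by-sizes (suc a) zero l≡a r≡0 =
    left (peakFree⇒VShaped l (subst (1 ≤_) (sym l≡a) (s≤s z≤n)) left-free)
         (subst (_≤ 1) (sym r≡0) z≤n)
  by-sizes (suc zero) (suc b) l≡1 r≡b =
    right (subst (_≤ 1) (sym l≡1) (s≤s z≤n))
          (peakFree⇒VShaped r (subst (1 ≤_) (sym r≡b) (s≤s z≤n)) right-free)
  by-sizes (suc (suc a)) (suc zero) l≡a r≡1 =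
    left (peakFree⇒VShaped l (subst (1 ≤_) (sym l≡a) (s≤s z≤n)) left-free)
         (subst (_≤ 1) (sym r≡1) (s≤s z≤n))
  -- The digit of this node exceeds all differences within the halves and has one on each side.
  by-sizes (suc (suc a)) (suc (suc b)) l≡a r≡b
    rewrite l≡a | r≡b
    with deltas l | deltas r | trans (length-deltas l) (cong pred l≡a)
       | trans (length-deltas r) (cong pred r≡b) | deltas-< l | deltas-< r
  ... | _ ∷ _ | _ ∷ _ | _ | _ | l<n | d<n ∷ _ = ⊥-elim (interior-peak l<n d<n p)

-- Difference sets of V-shaped trees

deltaSet-small : (t : Tree n) → size t ≤ 1 → deltaSet t ≡ ⊥
deltaSet-small (leaf _) _ = refl
deltaSet-small (node l r) t≤1 = cong₂ _∷_ (not-both (size l) (size r) t≤1) (begin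
  deltaSet l ∪ deltaSet r  ≡⟨ cong₂ _∪_ (deltaSet-small l (m+n≤o⇒m≤o (size l) t≤1))
                                        (deltaSet-small r (m+n≤o⇒n≤o (size l) t≤1)) ⟩
  ⊥ ∪ ⊥                    ≡⟨ ∪-identityˡ ⊥ ⟩
  ⊥                        ∎)
  where
  open ≡-Reasoning

  not-both : ∀ a b → a + b ≤ 1 → both a b ≡ false
  not-both zero       b       _        = refl
  not-both (suc a)    zero    _        = refl
  not-both (suc zero) (suc b) (s≤s ())

∪-smallˡ : (t : Tree n) (p : Subset n) → size t ≤ 1 → deltaSet t ∪ p ≡ p
∪-smallˡ t p t≤1 = trans (cong (_∪ p) (deltaSet-small t t≤1)) (∪-identityˡ p)

∪-smallʳ : (t : Tree n) (p : Subset n) → size t ≤ 1 → p ∪ deltaSet t ≡ p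
∪-smallʳ t p t≤1 = trans (cong (p ∪_) (deltaSet-small t t≤1)) (∪-identityʳ p)

-- At each node one half has no differences, so no digit is repeated and the union loses nothing.
size-VShaped : {t : Tree n} → VShaped t → size t ≡ suc ∣ deltaSet t ∣
size-VShaped leaf = refl
size-VShaped (right {l = l} {r} l≤1 v) rewrite ∪-smallˡ l (deltaSet r) l≤1 | size-VShaped v
  with size l | l≤1
... | zero     | _ = refl
... | suc zero | _ = refl
... | suc (suc _) | s≤s ()
size-VShaped (left {l = l} {r} v r≤1) rewrite ∪-smallʳ r (deltaSet l) r≤1 | size-VShaped v
  with size r | r≤1
... | zero     | _ = cong suc (+-identityʳ _)
... | suc zero | _ = cong suc (+-comm _ 1)
... | suc (suc _) | s≤s ()

record Realizes (t : Tree n) (T : Subset n) : Set where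
  constructor realizes
  field
    witness   : Tree n
    ⊑-tree    : witness ⊑ t
    size≡     : size witness ≡ suc ∣ T ∣
    deltaSet≡ : deltaSet witness ≡ T

-- Going down the V, the small half of a node is kept if its digit is in `T` and emptied otherwise;
-- each kept half adds one element and one difference.
realize : {t : Tree n} → VShaped t → (T : Subset n) → T ⊆ deltaSet t → Realizes t T
realize leaf [] _ = realizes (leaf true) same refl refl
realize {suc n} (right {l = l} {r} l≤1 v) (b ∷ T) T⊆
  rewrite ∪-smallˡ l (deltaSet r) l≤1
  with realizes y y⊑r size≡ deltaSet≡ ← realize v T (drop-∷-⊆ T⊆)
  with b
... | false = realizes (node ∅ y) (node ∅-least y⊑r)
  (trans (cong (_+ size y) (size-∅ n)) size≡)
  (cong₂ _∷_ (cong (λ a → both a (size y)) (size-∅ n))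
             (trans (∪-smallˡ ∅ (deltaSet y) (subst (_≤ 1) (sym (size-∅ n)) z≤n)) deltaSet≡))
-- `T⊆ here` says that both halves are nonempty, so the small one is a singleton.
... | true with size l in l≡a | size r | l≤1 | T⊆ here
...   | suc zero | suc _ | s≤s z≤n | here = realizes (node l y) (node ⊑-refl y⊑r)
  (cong₂ _+_ l≡a size≡)
  (cong₂ _∷_ (cong₂ both l≡a size≡)
             (trans (∪-smallˡ l (deltaSet y) (subst (_≤ 1) (sym l≡a) (s≤s z≤n))) deltaSet≡))
realize {suc n} (left {l = l} {r} v r≤1) (b ∷ T) T⊆
  rewrite ∪-smallʳ r (deltaSet l) r≤1
  with realizes y y⊑l size≡ deltaSet≡ ← realize v T (drop-∷-⊆ T⊆)
  with b
... | false = realizes (node y ∅) (node y⊑l ∅-least)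
  (trans (cong (size y +_) (size-∅ n)) (trans (+-identityʳ (size y)) size≡))
  (cong₂ _∷_ (trans (cong (both (size y)) (size-∅ n)) (both-zeroʳ (size y)))
             (trans (∪-smallʳ ∅ (deltaSet y) (subst (_≤ 1) (sym (size-∅ n)) z≤n)) deltaSet≡))
... | true with size l | size r in r≡b | r≤1 | T⊆ here
...   | suc _ | suc zero | s≤s z≤n | here = realizes (node y r) (node y⊑l ⊑-refl)
  (trans (cong₂ _+_ size≡ r≡b) (cong suc (+-comm _ 1)))
  (cong₂ _∷_ (cong₂ both size≡ r≡b)
             (trans (∪-smallʳ r (deltaSet y) (subst (_≤ 1) (sym r≡b) (s≤s z≤n))) deltaSet≡))

-- Trees and subsets

∣++∣ : ∀ {m} (p : Subset m) (q : Subset n) → ∣ p ++ⱽ q ∣ ≡ ∣ p ∣ + ∣ q ∣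
∣++∣ []          q = refl
∣++∣ (true ∷ p)  q = cong suc (∣++∣ p q)
∣++∣ (false ∷ p) q = ∣++∣ p q

++-mono-⊆ : ∀ {m} {p p′ : Subset m} {q q′ : Subset n} →
  p ⊆ p′ → q ⊆ q′ → p ++ⱽ q ⊆ p′ ++ⱽ q′
++-mono-⊆ {p = []}    {[]}    _    q⊆q′ x∈ = q⊆q′ x∈
++-mono-⊆ {p = _ ∷ _} {_ ∷ _} p⊆p′ q⊆q′ here with here ← p⊆p′ here = here
++-mono-⊆ {p = _ ∷ _} {_ ∷ _} p⊆p′ q⊆q′ (there x∈) =
  there (++-mono-⊆ (drop-∷-⊆ p⊆p′) q⊆q′ x∈)

-- The final `[]` matches `2 ^ suc n`, which unfolds to `2 ^ n + (2 ^ n + 0)`.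
toSubset : Tree n → Subset (2 ^ n)
toSubset (leaf b)   = b ∷ []
toSubset (node l r) = toSubset l ++ⱽ toSubset r ++ⱽ []

toTree : Subset (2 ^ n) → Tree n
toTree {zero}  (b ∷ []) = leaf b
toTree {suc n} X        = node (toTree (take (2 ^ n) X)) (toTree (take (2 ^ n) (dropⱽ (2 ^ n) X)))

toSubset-toTree : ∀ n (X : Subset (2 ^ n)) → toSubset (toTree {n} X) ≡ X
toSubset-toTree zero    (b ∷ []) = refl
toSubset-toTree (suc n) X
  rewrite toSubset-toTree n (take (2 ^ n) X)
        | toSubset-toTree n (take (2 ^ n) (dropⱽ (2 ^ n) X)) =
  trans (cong (take (2 ^ n) X ++ⱽ_) rest) (take++drop≡id (2 ^ n) X)
  where
  rest : take (2 ^ n) (dropⱽ (2 ^ n) X) ++ⱽ [] ≡ dropⱽ (2 ^ n) X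
  rest with dropⱽ (2 ^ n) (dropⱽ (2 ^ n) X) | take++drop≡id (2 ^ n) (dropⱽ (2 ^ n) X)
  ... | [] | eq = eq

toTree-toSubset : (t : Tree n) → toTree (toSubset t) ≡ t
toTree-toSubset (leaf b) = refl
toTree-toSubset (node l r) = cong₂ node
  (trans (cong toTree (take-++ (toSubset l))) (toTree-toSubset l))
  (trans (cong toTree (trans (cong (take _) (drop-++ (toSubset l))) (take-++ (toSubset r))))
         (toTree-toSubset r))
  where
  take-++ : ∀ {m o} (p : Vec Bool m) {q : Vec Bool o} → take m (p ++ⱽ q) ≡ p
  take-++ []      = refl
  take-++ (b ∷ p) = cong (b ∷_) (take-++ p)

  drop-++ : ∀ {m o} (p : Vec Bool m) {q : Vec Bool o} → dropⱽ m (p ++ⱽ q) ≡ q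
  drop-++ []      = refl
  drop-++ (b ∷ p) = drop-++ p

toSubset-mono : {t u : Tree n} → t ⊑ u → toSubset t ⊆ toSubset u
toSubset-mono (empty {true}) (there ())
toSubset-mono (empty {false}) x∈ = x∈
toSubset-mono same       x∈ = x∈
toSubset-mono (node p q) x∈ =
  ++-mono-⊆ (toSubset-mono p) (++-mono-⊆ (toSubset-mono q) ⊆-refl) x∈

∣toSubset∣ : (t : Tree n) → ∣ toSubset t ∣ ≡ size t
∣toSubset∣ (leaf true)  = refl
∣toSubset∣ (leaf false) = refl
∣toSubset∣ (node l r)   = begin
  ∣ toSubset l ++ⱽ toSubset r ++ⱽ [] ∣       ≡⟨ ∣++∣ (toSubset l) _ ⟩
  ∣ toSubset l ∣ + ∣ toSubset r ++ⱽ [] ∣     ≡⟨ cong (∣ toSubset l ∣ +_) (∣++∣ (toSubset r) []) ⟩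
  ∣ toSubset l ∣ + (∣ toSubset r ∣ + 0)      ≡⟨ cong₂ _+_ (∣toSubset∣ l)
                                                 (trans (+-identityʳ _) (∣toSubset∣ r)) ⟩
  size l + size r                            ∎
  where open ≡-Reasoning

-- Extracting a colouring from a negated arrow

-- A total colouring g : Subset n → Fin k restricts to a colouring of the r-subsets.
Avoids : ∀ {k} → ℕ → Vector ℕ k → (Subset n → Fin k) → Set
Avoids {n} r s g = ∀ i (X : Subset n) → ∣ X ∣ ≡ s i →
  ¬ (∀ T → ∣ T ∣ ≡ r → T ⊆ X → g T ≡ i)

encode : Subset n → Fin (2 ^ n)
encode T = funToFin (Inverse.from 2↔Bool ∘ lookup T)

decode : Fin (2 ^ n) → Subset n
decode c = tabulate (Inverse.to 2↔Bool ∘ finToFun c)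

decode-encode : (T : Subset n) → decode (encode T) ≡ T
decode-encode T = trans (tabulate-cong bit) (tabulate∘lookup T)
  where
  bit : Inverse.to 2↔Bool ∘ finToFun (encode T) ≗ lookup T
  bit i = trans (cong (Inverse.to 2↔Bool) (finToFun-funToFin (Inverse.from 2↔Bool ∘ lookup T) i))
                (Inverse.strictlyInverseˡ 2↔Bool (lookup T i))

-- Constructively, a witness for the negated arrow comes from a finite search: numbering the subsets
-- turns total colourings into elements of `Fin (k ^ (2 ^ n))`, and `Arrows` is decidable.
↛⇒avoids : ∀ {k r} {s : Vector ℕ k} → Fin k → n ↛[ r ] s → ∃[ g ] Avoids {n} r s g
↛⇒avoids {n} {k} {r} {s} i₀ n↛s with ¬∀⟶∃¬ (k ^ (2 ^ n)) (Arrows ∘ colouring) (arrows? ∘ colouring) notAll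
  where
  Arrows : (Subset n → Fin k) → Set
  Arrows g = ∃[ i ] ∃[ X ] ∣ X ∣ ≡ s i × ¬ (∃[ T ] ∣ T ∣ ≡ r × T ⊆ X × g T ≢ i)

  arrows? : ∀ g → Dec (Arrows g)
  arrows? g = any? λ i → anySubset? λ X → (∣ X ∣ ≟ s i) ×-dec
    ¬? (anySubset? λ T → (∣ T ∣ ≟ r) ×-dec (T ⊆? X) ×-dec ¬? (g T ≟ᶠ i))

  colouring : Fin (k ^ (2 ^ n)) → Subset n → Fin k
  colouring c = finToFun c ∘ encode

  extend : Colouring n r k → Subset n → Fin k
  extend f T with ∣ T ∣ ≟ r
  ... | yes ∣T∣≡r = f (T , ∣T∣≡r)
  -- A default that makes the function total; `Arrows` tests only sets of size r.
  ... | no  _     = i₀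

  extend-≡ : ∀ f (T : SubsetOfSize n r) → extend f (proj₁ T) ≡ f T
  extend-≡ f (T , ∣T∣≡r) with ∣ T ∣ ≟ r
  ... | yes eq = cong (λ e → f (T , e)) (≡-irrelevant eq ∣T∣≡r)
  ... | no neq = contradiction ∣T∣≡r neq

  notAll : ¬ (∀ c → Arrows (colouring c))
  notAll all = n↛s λ f →
    let c = funToFin (extend f ∘ decode)
        colouring-c : ∀ T → colouring c (proj₁ T) ≡ f T
        colouring-c = λ T → trans (finToFun-funToFin (extend f ∘ decode) (encode (proj₁ T)))
          (trans (cong (extend f) (decode-encode (proj₁ T))) (extend-≡ f T))
        i , X , ∣X∣≡ , mono = all c
    in i , X , ∣X∣≡ , λ T T⊆X → trans (sym (colouring-c T))
         (decidable-stable (_ ≟ᶠ i) λ ≢i → mono (proj₁ T , proj₂ T , T⊆X , ≢i))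
... | c , ¬arrows = _ , λ i X ∣X∣≡ mono →
  ¬arrows (i , X , ∣X∣≡ , λ (T , ∣T∣≡r , T⊆X , ≢i) → ≢i (mono T ∣T∣≡r T⊆X))

-- The stepped-up colouring

-- Here `r` is the excess over 3: sets of size 3 + r are coloured by `g`, those of size 4 + r by the
-- new colouring.
module SteppingUp {n k h r : ℕ} (g : Subset n → Fin k) (sep : Separating (3 + r) h) where
  open Separating sep
  open ≡-Reasoning

  word : Tree n → List Bool
  word t = peaks (deltas t)

  paint : Fin k → Maybe (Fin h) → Fin (k + h)
  paint i nothing  = i ↑ˡ h
  paint _ (just j) = k ↑ʳ j

  newColour : Fin (k + h) → Maybe (Fin h)
  newColour c = [ const nothing , just ]′ (splitAt k c)

  newColour-paint : ∀ i m → newColour (paint i m) ≡ m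
  newColour-paint i nothing  = cong [ const nothing , just ]′ (splitAt-↑ˡ k i h)
  newColour-paint i (just j) = cong [ const nothing , just ]′ (splitAt-↑ʳ k h j)

  -- Differences can repeat when there are peaks, so `deltaSet t` may be too small for a colouring
  -- of (3 + r)-sets; hence `g` is total.
  colour : Tree n → Fin (k + h)
  colour t = paint (g (deltaSet t)) (classify (word t))

  newColour-colour : ∀ t → newColour (colour t) ≡ classify (word t)
  newColour-colour t = newColour-paint (g (deltaSet t)) (classify (word t))

  colour-original : ∀ t {i} → colour t ≡ i ↑ˡ h → g (deltaSet t) ≡ i
  colour-original t {i} eq = ↑ˡ-injective h _ i (trans (cong (paint _) (sym original)) eq)
    where
    original : classify (word t) ≡ nothing
    original = trans (sym (newColour-colour t))
      (trans (cong newColour eq) (newColour-paint i nothing))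

  Mono : Fin (k + h) → Tree n → Set
  Mono c t = ∀ u → u ⊑ t → size u ≡ 4 + r → colour u ≡ c

  mono-⊑ : ∀ {c t u} → u ⊑ t → Mono c t → Mono c u
  mono-⊑ u⊑t mono v v⊑u = mono v (⊑-trans v⊑u u⊑t)

  classify-mono : ∀ {c t} → Mono c t → ∀ u → u ⊑ t → size u ≡ 4 + r →
    classify (word u) ≡ newColour c
  classify-mono mono u u⊑t size≡ = trans (sym (newColour-colour u)) (cong newColour (mono u u⊑t size≡))

  -- Induction on the excess `e` over 5 + r. At 0, removing either end leaves sets of equal colour,
  -- so `separates` applies; later, the words of the two smaller sets cover the whole word.
  mono⇒peakFree : ∀ {c} e t → size t ≡ e + (5 + r) → Mono c t → PeakFree (deltas t)
  mono⇒peakFree zero t size≡ mono =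
    separates (word t) (length-word t size≡) (peaks-sparse (deltas t)) (begin
      classify (drop 1 (word t))    ≡⟨ cong classify (peaks-drop (deltas t)) ⟨
      classify (peaks (drop 1 (deltas t)))
                                    ≡⟨ cong (classify ∘ peaks) (deltas-dropMin t) ⟨
      classify (word (dropMin t))   ≡⟨ classify-mono mono (dropMin t) (dropMin-⊑ t)
                                         (trans (size-dropMin t) (cong pred size≡)) ⟩
      newColour _                   ≡⟨ classify-mono mono (dropMax t) (dropMax-⊑ t)
                                         (trans (size-dropMax t) (cong pred size≡)) ⟨
      classify (word (dropMax t))   ≡⟨ cong (classify ∘ peaks) (deltas-dropMax t) ⟩
      classify (peaks (dropLast (deltas t)))
                                    ≡⟨ cong classify (peaks-dropLast (deltas t)) ⟩
      classify (dropLast (word t))  ∎)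
    where
    length-word : ∀ t → size t ≡ 5 + r → length (word t) ≡ 2 + r
    length-word t size≡ = trans (length-peaks (deltas t))
      (cong (_∸ 2) (trans (length-deltas t) (cong pred size≡)))
  mono⇒peakFree (suc e) t size≡ mono = noTrue-ends (word t) length≡
    (subst NoTrue (trans (cong peaks (deltas-dropMin t)) (peaks-drop (deltas t)))
      (mono⇒peakFree e (dropMin t) (trans (size-dropMin t) (cong pred size≡))
        (mono-⊑ (dropMin-⊑ t) mono)))
    (subst NoTrue (trans (cong peaks (deltas-dropMax t)) (peaks-dropLast (deltas t)))
      (mono⇒peakFree e (dropMax t) (trans (size-dropMax t) (cong pred size≡))
        (mono-⊑ (dropMax-⊑ t) mono)))
    where
    length≡ : length (word t) ≡ 2 + (e + suc r)
    length≡ = trans (length-peaks (deltas t)) (trans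
      (cong (_∸ 2) (trans (length-deltas t) (cong pred size≡)))
      (cong (_∸ 2) (+-4 e)))
      where
      +-4 : ∀ e → e + (5 + r) ≡ 4 + (e + suc r)
      +-4 zero    = refl
      +-4 (suc e) = cong suc (+-4 e)

  no-new : ∀ j t → size t ≡ 5 + r → ¬ Mono (k ↑ʳ j) t
  no-new j t size≡ mono with () ← begin
    -- `g ⊥` is an arbitrary colour: `paint` discards it on `just j`.
    just j                       ≡⟨ newColour-paint (g ⊥) (just j) ⟨
    newColour (k ↑ʳ j)           ≡⟨ classify-mono mono (dropMin t) (dropMin-⊑ t)
                                     (trans (size-dropMin t) (cong pred size≡)) ⟨
    classify (word (dropMin t))  ≡⟨ noTrue⇒nothing (subst PeakFree (sym (deltas-dropMin t))
                                     (peakFree-drop (deltas t) (mono⇒peakFree 0 t size≡ mono))) ⟩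
    nothing                      ∎

  -- The bound on `m` gives `t` at least 5 + r elements, so it is peak-free. Each (3 + r)-subset of
  -- `deltaSet t` then comes from a (4 + r)-subset of `t`, whose colour determines its value under
  -- `g`.
  original-mono : ∀ {i} m t → 4 + r ≤ m → size t ≡ suc m → Mono (i ↑ˡ h) t →
    ∃[ X ] ∣ X ∣ ≡ m × (∀ T → ∣ T ∣ ≡ 3 + r → T ⊆ X → g T ≡ i)
  original-mono {i} m t 4+r≤m size≡ mono with m≤n⇒∃[o]m+o≡n 4+r≤m
  ... | e , refl = deltaSet t , suc-injective (trans (sym (size-VShaped v-shaped)) size≡) , colours
    where
    v-shaped : VShaped t
    v-shaped = peakFree⇒VShaped t (subst (1 ≤_) (sym size≡) (s≤s z≤n))
      (mono⇒peakFree e t (trans size≡ (+-comm (5 + r) e)) mono)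

    colours : ∀ T → ∣ T ∣ ≡ 3 + r → T ⊆ deltaSet t → g T ≡ i
    colours T ∣T∣≡ T⊆ with realize v-shaped T T⊆
    ... | realizes u u⊑t u-size refl =
      colour-original u (mono u u⊑t (trans u-size (cong suc ∣T∣≡)))

-- Transfer from trees to subsets

theorem1p1 : (k n r : ℕ) → 2 ≤ k → 3 ≤ r → r < n →
    (s : Vector ℕ k) → (∀ i → r + 1 ≤ s i × s i ≤ n) →
    n ↛[ r ] s →
    (2 ^ n ↛[ r + 1 ] (map (_+ 1) s ++ replicate (η r) (r + 2)))
    × (Σ[ F ∈ Colouring (2 ^ n) (r + 1) (k + η r) ]
         ((i : Fin k) (X : Subset (2 ^ n)) → ∣ X ∣ ≡ s i + 1 →
            ¬ Monochromatic F (i ↑ˡ η r) X)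
         × ((j : Fin (η r)) (X : Subset (2 ^ n)) → ∣ X ∣ ≡ r + 2 →
            ¬ Monochromatic F (k ↑ʳ j) X))
theorem1p1 k n r@(suc (suc (suc q))) (s≤s _) 3≤r@(s≤s (s≤s (s≤s _))) _ s s-bounds n↛s
  -- Matching on `2 ≤ k` makes `k` a successor, so `zero` can serve as the default colour.
  with ↛⇒avoids {s = s} zero n↛s
... | g , avoids = no-arrow , F , no-old , no-extra
  where
  open SteppingUp g (separating 3≤r)

  F : Colouring (2 ^ n) (r + 1) (k + η r)
  F (T , _) = colour (toTree T)

  mono-tree : ∀ {c X} → Monochromatic F c X → Mono c (toTree X)
  mono-tree {c} {X} mono u u⊑ size≡ = trans (cong colour (sym (toTree-toSubset u)))
    (mono (toSubset u , trans (∣toSubset∣ u) (trans size≡ (+-comm 1 r)))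
      (subst (toSubset u ⊆_) (toSubset-toTree n X) (toSubset-mono u⊑)))

  size-tree : ∀ X → size (toTree {n} X) ≡ ∣ X ∣
  size-tree X = trans (sym (∣toSubset∣ (toTree {n} X))) (cong ∣_∣ (toSubset-toTree n X))

  no-old : (i : Fin k) (X : Subset (2 ^ n)) → ∣ X ∣ ≡ s i + 1 →
    ¬ Monochromatic F (i ↑ˡ η r) X
  no-old i X ∣X∣≡ mono
    with original-mono (s i) (toTree X) (subst (_≤ s i) (+-comm r 1) (proj₁ (s-bounds i)))
           (trans (size-tree X) (trans ∣X∣≡ (+-comm (s i) 1))) (mono-tree mono)
  ... | Y , ∣Y∣≡ , mono-Y = avoids i Y ∣Y∣≡ mono-Y

  no-extra : (j : Fin (η r)) (X : Subset (2 ^ n)) → ∣ X ∣ ≡ r + 2 →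
    ¬ Monochromatic F (k ↑ʳ j) X
  no-extra j X ∣X∣≡ mono =
    no-new j (toTree X) (trans (size-tree X) (trans ∣X∣≡ (+-comm r 2))) (mono-tree mono)

  no-arrow : 2 ^ n ↛[ r + 1 ] (map (_+ 1) s ++ replicate (η r) (r + 2))
  no-arrow arrow with arrow F
  ... | c , X , ∣X∣≡ , mono with splitAt k c in eq
  ...   | inj₁ i = no-old i X ∣X∣≡ (subst (λ c → Monochromatic F c X) (sym (splitAt⁻¹-↑ˡ eq)) mono)
  ...   | inj₂ j = no-extra j X ∣X∣≡ (subst (λ c → Monochromatic F c X) (sym (splitAt⁻¹-↑ʳ {i = c} eq)) mono)
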